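{- For all integers $m\geq 2$ and $k\geq1$, $$\zeta_{\mathcal P}(\{m\}^k)=\sum_{\substack{\lambda=(a_1,\ldots,a_j)\in\mathcal C\\ |\lambda|=k}}\zeta(a_1m,a_2m,\ldots,a_jm).$$
   Context: For a partition $\lambda$, $\ell(\lambda)$ is its number of parts and $n_\lambda$ the product of its parts; $\zeta_{\mathcal P}(\{m\}^k):=\sum_{\ell(\lambda)=k}n_\lambda^{ -m}$, the sum over all integer partitions of length $k$, i.e. $\sum_{n_1\geq n_2\geq\dots\geq n_k\geq1}(n_1\cdots n_k)^{ -m}$. A composition is a finite tuple $\lambda=(a_1,\dots,a_j)$ of positive integers, of size $|\lambda|:=a_1+\dots+a_j$; $\mathcal C$ is the set of all compositions. For positive integers $m_1,\dots,m_j$ with $m_1\geq2$, the multiple zeta value is $\zeta(m_1,\dots,m_j):=\sum_{n_1>n_2>\dots>n_j\geq1}\frac{1}{n_1^{m_1}\cdots n_j^{m_j}}$. -}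

module Defs where

open import Data.Nat.Base as ℕ using (ℕ; zero; suc; z≤n; s≤s)
import Data.Nat.Properties as ℕ
open import Data.Nat.ListAction using (sum; product)
open import Data.Integer.Base as ℤ using (ℤ; +_; -[1+_])
import Data.Integer.Properties as ℤ
open import Data.Rational.Base
  using (ℚ; mkℚ; 0ℚ; 1ℚ; ½; _+_; _*_; _-_; -_; _/_; 1/_; ∣_∣; _≤_; _<_; *≤*; toℚᵘ; fromℚᵘ;
         nonNegative; positive; Positive)
import Data.Rational.Base as ℚ
open import Data.Rational.Properties as ℚ using (≤-refl; ≤-trans; ≤-reflexive)
import Data.Rational.Unnormalised.Base as ℚᵘ
import Data.Rational.Unnormalised.Properties as ℚᵘ
open import Data.Rational.Solver using (module +-*-Solver)
open import Data.List.Base using (List; []; _∷_; _++_; map; foldr; length; zipWith; concatMap)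
open import Data.List.Properties using (∷-injectiveʳ)
open import Data.List.Membership.Propositional using (_∈_; lose)
open import Data.List.Membership.Propositional.Properties
  using (∈-map⁺; ∈-map⁻; ∈-++⁺ˡ; ∈-++⁺ʳ; ∈-++⁻; ∈-∃++; ∈-concatMap⁺)
open import Data.List.Relation.Binary.Disjoint.Propositional using (Disjoint)
open import Data.List.Relation.Binary.Subset.Propositional using (_⊆_)
open import Data.List.Relation.Unary.All as All using (All; []; _∷_)
import Data.List.Relation.Unary.All.Properties as All
open import Data.List.Relation.Unary.AllPairs as AllPairs using ([]; _∷_)
import Data.List.Relation.Unary.AllPairs.Properties as AllPairs
open import Data.List.Relation.Unary.Any using (here; there)
open import Data.List.Relation.Unary.Linked as Linked using (Linked; []; [-]; _∷_)
open import Data.List.Relation.Unary.Unique.Propositional using (Unique)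
import Data.List.Relation.Unary.Unique.Propositional.Properties as Unique
open import Data.Product.Base using (∃; _×_; _,_; proj₁; proj₂)
open import Data.Sum.Base using (inj₁; inj₂; [_,_]′)
open import Data.Unit.Base using (⊤; tt)
open import Data.Empty using (⊥-elim)
open import Function.Base using (_∘_; _$_; id)
open import Level using (0ℓ)
open import Relation.Binary.Core using (Rel)
open import Relation.Binary.PropositionalEquality
  using (_≡_; _≢_; refl; sym; trans; cong; cong₂; subst; subst₂; module ≡-Reasoning)
open import Relation.Unary using (Pred)

≤-from-gap : ∀ {p q} d → p + d ≡ q → 0ℚ ≤ d → p ≤ q
≤-from-gap {p} d refl 0≤d = subst (_≤ p + d) (ℚ.+-identityʳ p) (ℚ.+-monoʳ-≤ p 0≤d)

gap : ∀ {p q} → p ≤ q → 0ℚ ≤ q - p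
gap {p} {q} p≤q = subst (_≤ q - p) (ℚ.+-inverseʳ p) (ℚ.+-monoˡ-≤ (- p) p≤q)

0≤+ : ∀ {p q} → 0ℚ ≤ p → 0ℚ ≤ q → 0ℚ ≤ p + q
0≤+ {p} {q} 0≤p 0≤q = subst (_≤ p + q) (ℚ.+-identityʳ 0ℚ) (ℚ.+-mono-≤ 0≤p 0≤q)

*-monoʳ : ∀ {p q r} → 0ℚ ≤ r → p ≤ q → r * p ≤ r * q
*-monoʳ {r = r} 0≤r p≤q = ℚ.*-monoˡ-≤-nonNeg r {{nonNegative 0≤r}} p≤q

*-monoˡ : ∀ {p q r} → 0ℚ ≤ r → p ≤ q → p * r ≤ q * r
*-monoˡ {r = r} 0≤r p≤q = ℚ.*-monoʳ-≤-nonNeg r {{nonNegative 0≤r}} p≤q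

0≤* : ∀ {p q} → 0ℚ ≤ p → 0ℚ ≤ q → 0ℚ ≤ p * q
0≤* {p} {q} 0≤p 0≤q = subst (_≤ p * q) (ℚ.*-zeroʳ p) (*-monoʳ 0≤p 0≤q)

*-mono : ∀ {p q r s} → 0ℚ ≤ r → 0ℚ ≤ q → p ≤ q → r ≤ s → p * r ≤ q * s
*-mono 0≤r 0≤q p≤q r≤s = ≤-trans (*-monoˡ 0≤r p≤q) (*-monoʳ 0≤q r≤s)

0≤1 : 0ℚ ≤ 1ℚ
0≤1 = ℚ.nonNegative⁻¹ 1ℚ

half : ∀ {ε} → 0ℚ < ε → 0ℚ < ½ * ε
half {ε} 0<ε = subst (_< ½ * ε) (ℚ.*-zeroʳ ½) (ℚ.*-monoʳ-<-pos ½ 0<ε)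

half+half : ∀ ε → ½ * ε + ½ * ε ≡ ε
half+half ε = trans (sym (ℚ.*-distribʳ-+ ε ½ ½)) (ℚ.*-identityˡ ε)

∣-∣≤ : ∀ {p q ε} → p ≤ q + ε → q ≤ p + ε → ∣ p - q ∣ ≤ ε
∣-∣≤ {p} {q} {ε} h₁ h₂ with ℚ.∣p∣≡p∨∣p∣≡-p (p - q)
... | inj₁ eq = subst (_≤ ε) (sym eq) $
  ≤-from-gap (q + ε - p) (solve 3 (λ p q ε → (p :- q) :+ (q :+ ε :- p) := ε) refl p q ε) (gap h₁)
  where open +-*-Solver
... | inj₂ eq = subst (_≤ ε) (sym eq) $
  ≤-from-gap (p + ε - q) (solve 3 (λ p q ε → :- (p :- q) :+ (p :+ ε :- q) := ε) refl p q ε) (gap h₂)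
  where open +-*-Solver

fromℕ : ℕ → ℚ
fromℕ n = + n / 1

-- The value at 0 is a junk value.
recip : ℕ → ℚ
recip zero    = 0ℚ
recip (suc n) = + 1 / suc n

toℚᵘ-fromℕ : ∀ n → toℚᵘ (fromℕ n) ℚᵘ.≃ ℚᵘ.mkℚᵘ (+ n) 0
toℚᵘ-fromℕ n = ℚ.toℚᵘ-fromℚᵘ (ℚᵘ.mkℚᵘ (+ n) 0)

fromℕ-* : ∀ m n → fromℕ (m ℕ.* n) ≡ fromℕ m * fromℕ n
fromℕ-* m n = ℚ.toℚᵘ-injective $ begin
  toℚᵘ (fromℕ (m ℕ.* n))                  ≈⟨ toℚᵘ-fromℕ (m ℕ.* n) ⟩
  ℚᵘ.mkℚᵘ (+ (m ℕ.* n)) 0                 ≈⟨ ℚᵘ.*≡* (cong (ℤ._* + 1) (ℤ.pos-* m n)) ⟩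
  ℚᵘ.mkℚᵘ (+ m) 0 ℚᵘ.* ℚᵘ.mkℚᵘ (+ n) 0    ≈⟨ ℚᵘ.≃-sym (ℚᵘ.*-cong (toℚᵘ-fromℕ m) (toℚᵘ-fromℕ n)) ⟩
  toℚᵘ (fromℕ m) ℚᵘ.* toℚᵘ (fromℕ n)      ≈⟨ ℚᵘ.≃-sym (ℚ.toℚᵘ-homo-* (fromℕ m) (fromℕ n)) ⟩
  toℚᵘ (fromℕ m * fromℕ n)                ∎
  where open ℚᵘ.≃-Reasoning

fromℕ-suc : ∀ n → fromℕ (suc n) ≡ 1ℚ + fromℕ n
fromℕ-suc n = ℚ.toℚᵘ-injective $ begin
  toℚᵘ (fromℕ (suc n))              ≈⟨ toℚᵘ-fromℕ (suc n) ⟩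
  ℚᵘ.mkℚᵘ (+ suc n) 0               ≈⟨ ℚᵘ.*≡* (cong (λ k → (ℤ.1ℤ ℤ.+ k) ℤ.* ℤ.1ℤ) (sym (ℤ.*-identityʳ (+ n)))) ⟩
  ℚᵘ.1ℚᵘ ℚᵘ.+ ℚᵘ.mkℚᵘ (+ n) 0       ≈⟨ ℚᵘ.≃-sym (ℚᵘ.+-congʳ ℚᵘ.1ℚᵘ (toℚᵘ-fromℕ n)) ⟩
  toℚᵘ 1ℚ ℚᵘ.+ toℚᵘ (fromℕ n)       ≈⟨ ℚᵘ.≃-sym (ℚ.toℚᵘ-homo-+ 1ℚ (fromℕ n)) ⟩
  toℚᵘ (1ℚ + fromℕ n)               ∎
  where open ℚᵘ.≃-Reasoning

recip*fromℕ : ∀ n → recip (suc n) * fromℕ (suc n) ≡ 1ℚ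
recip*fromℕ n = ℚ.toℚᵘ-injective $ begin
  toℚᵘ (recip (suc n) * fromℕ (suc n))              ≈⟨ ℚ.toℚᵘ-homo-* (recip (suc n)) (fromℕ (suc n)) ⟩
  toℚᵘ (recip (suc n)) ℚᵘ.* toℚᵘ (fromℕ (suc n))    ≈⟨ ℚᵘ.*-cong (ℚ.toℚᵘ-fromℚᵘ (ℚᵘ.mkℚᵘ (+ 1) n)) (toℚᵘ-fromℕ (suc n)) ⟩
  ℚᵘ.mkℚᵘ (+ 1) n ℚᵘ.* ℚᵘ.mkℚᵘ (+ suc n) 0          ≈⟨ ℚᵘ.*≡* (cong (+_ ∘ suc) (trans (ℕ.*-identityʳ (n ℕ.+ 0)) (cong (ℕ._+ 0) (sym (ℕ.*-identityʳ n))))) ⟩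
  ℚᵘ.1ℚᵘ                                            ∎
  where open ℚᵘ.≃-Reasoning

0≤fromℕ : ∀ n → 0ℚ ≤ fromℕ n
0≤fromℕ zero    = ≤-refl
0≤fromℕ (suc n) = subst (0ℚ ≤_) (sym (fromℕ-suc n)) (0≤+ 0≤1 (0≤fromℕ n))

fromℕ-mono : ∀ {m n} → m ℕ.≤ n → fromℕ m ≤ fromℕ n
fromℕ-mono {n = n} z≤n = 0≤fromℕ n
fromℕ-mono {suc m} {suc n} (s≤s m≤n) =
  subst₂ _≤_ (sym (fromℕ-suc m)) (sym (fromℕ-suc n)) (ℚ.+-monoʳ-≤ 1ℚ (fromℕ-mono m≤n))

0≤recip : ∀ n → 0ℚ ≤ recip n
0≤recip zero    = ≤-refl
0≤recip (suc n) = ℚ.nonNegative⁻¹ (recip (suc n)) {{ℚ.normalize-nonNeg 1 (suc n)}}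

recip-antitone : ∀ {m n} → 1 ℕ.≤ m → m ℕ.≤ n → recip n ≤ recip m
recip-antitone {suc m} {suc n} _ m≤n = subst₂ _≤_ eq₁ eq₂ step
  where
  a = recip (suc m)
  b = recip (suc n)
  step : (a * b) * fromℕ (suc m) ≤ (a * b) * fromℕ (suc n)
  step = *-monoʳ (0≤* (0≤recip (suc m)) (0≤recip (suc n))) (fromℕ-mono m≤n)
  open +-*-Solver
  eq₁ : (a * b) * fromℕ (suc m) ≡ b
  eq₁ = trans (solve 3 (λ a b x → (a :* b) :* x := (a :* x) :* b) refl a b (fromℕ (suc m)))
              (trans (cong (_* b) (recip*fromℕ m)) (ℚ.*-identityˡ b))
  eq₂ : (a * b) * fromℕ (suc n) ≡ a
  eq₂ = trans (ℚ.*-assoc a b _) (trans (cong (a *_) (recip*fromℕ n)) (ℚ.*-identityʳ a))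

recip-* : ∀ m n → recip (m ℕ.* n) ≡ recip m * recip n
recip-* zero    n       = sym (ℚ.*-zeroˡ (recip n))
recip-* (suc m) zero    = trans (cong recip (ℕ.*-zeroʳ m)) (sym (ℚ.*-zeroʳ (recip (suc m))))
recip-* (suc m) (suc n) = begin
  c                     ≡⟨ sym (trans (cong₂ (λ u v → (c * u) * v) (recip*fromℕ m) (recip*fromℕ n)) (trans (ℚ.*-identityʳ _) (ℚ.*-identityʳ c))) ⟩
  (c * (a * x)) * (b * y) ≡⟨ solve 5 (λ a b c x y → (c :* (a :* x)) :* (b :* y) := (c :* (x :* y)) :* (a :* b)) refl a b c x y ⟩
  (c * (x * y)) * (a * b) ≡⟨ cong (λ u → (c * u) * (a * b)) (sym (fromℕ-* (suc m) (suc n))) ⟩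
  (c * fromℕ (suc m ℕ.* suc n)) * (a * b) ≡⟨ cong (_* (a * b)) (recip*fromℕ (n ℕ.+ m ℕ.* suc n)) ⟩
  1ℚ * (a * b)          ≡⟨ ℚ.*-identityˡ (a * b) ⟩
  a * b                 ∎
  where
  a = recip (suc m)
  b = recip (suc n)
  c = recip (suc m ℕ.* suc n)
  x = fromℕ (suc m)
  y = fromℕ (suc n)
  open +-*-Solver
  open ≡-Reasoning

recip-^-≤ : ∀ n {s} → 1 ℕ.≤ s → recip (suc n ℕ.^ s) ≤ recip (suc n)
recip-^-≤ n {suc s} _ = recip-antitone (s≤s z≤n)
  (ℕ.m≤m*n (suc n) (suc n ℕ.^ s) {{ℕ.m^n≢0 (suc n) s}})

recip-^-≤² : ∀ n {s} → 2 ℕ.≤ s → recip (suc n ℕ.^ s) ≤ recip (suc n) * recip (suc n)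
recip-^-≤² n {suc s} (s≤s 1≤s) = ≤-trans (≤-reflexive (recip-* (suc n) (suc n ℕ.^ s)))
  (*-monoʳ (0≤recip (suc n)) (recip-^-≤ n 1≤s))

recip-telescope : ∀ n → recip (2 ℕ.+ n) * recip (2 ℕ.+ n) + recip (2 ℕ.+ n) ≤ recip (suc n)
recip-telescope n = subst (r * r + r ≤_) (sym r′≡) (ℚ.+-monoˡ-≤ r (*-monoʳ (0≤recip (2 ℕ.+ n)) r≤r′))
  where
  r  = recip (2 ℕ.+ n)
  r′ = recip (suc n)
  r≤r′ : r ≤ r′
  r≤r′ = recip-antitone (s≤s z≤n) (ℕ.n≤1+n (suc n))
  open +-*-Solver
  open ≡-Reasoning
  r′≡ : r′ ≡ r * r′ + r
  r′≡ = begin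
    r′                                   ≡⟨ sym (trans (cong (r′ *_) (recip*fromℕ (suc n))) (ℚ.*-identityʳ r′)) ⟩
    r′ * (r * fromℕ (2 ℕ.+ n))           ≡⟨ cong (λ z → r′ * (r * z)) (fromℕ-suc (suc n)) ⟩
    r′ * (r * (1ℚ + fromℕ (suc n)))      ≡⟨ solve 3 (λ r r′ x → r′ :* (r :* (con 1ℚ :+ x)) := r :* r′ :+ r :* (r′ :* x)) refl r r′ (fromℕ (suc n)) ⟩
    r * r′ + r * (r′ * fromℕ (suc n))    ≡⟨ cong (λ z → r * r′ + r * z) (recip*fromℕ n) ⟩
    r * r′ + r * 1ℚ                      ≡⟨ cong (_+_ (r * r′)) (ℚ.*-identityʳ r) ⟩
    r * r′ + r                           ∎

≤-fromℕ : ∀ p → ∃ λ n → p ≤ fromℕ n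
≤-fromℕ (mkℚ (+ n) d c) = n , ℚ.toℚᵘ-cancel-≤ (ℚᵘ.≤-respʳ-≃ (ℚᵘ.≃-sym (toℚᵘ-fromℕ n)) n/d≤n)
  where
  n/d≤n : ℚᵘ.mkℚᵘ (+ n) d ℚᵘ.≤ ℚᵘ.mkℚᵘ (+ n) 0
  n/d≤n = ℚᵘ.*≤* (subst₂ ℤ._≤_ (ℤ.pos-* n 1) (ℤ.pos-* n (suc d)) (ℤ.+≤+ (ℕ.*-monoʳ-≤ n (s≤s z≤n))))
≤-fromℕ (mkℚ -[1+ n ] d _) = 0 , *≤* ℤ.-≤+

archimedean : ∀ p {ε} → 0ℚ < ε → ∃ λ N → ∀ n → N ℕ.≤ n → p ≤ ε * fromℕ n
archimedean p {ε} 0<ε = N , λ n N≤n →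
  ≤-trans (≤-reflexive (sym eq)) (*-monoʳ 0≤ε (≤-trans (proj₂ bound) (fromℕ-mono N≤n)))
  where
  instance
    ε-pos : Positive ε
    ε-pos = positive 0<ε
    ε-nz : ℚ.NonZero ε
    ε-nz = ℚ.pos⇒nonZero ε
  0≤ε = ℚ.<⇒≤ 0<ε
  bound = ≤-fromℕ (1/ ε * p)
  N = proj₁ bound
  eq : ε * (1/ ε * p) ≡ p
  eq = trans (sym (ℚ.*-assoc ε (1/ ε) p)) (trans (cong (_* p) (ℚ.*-inverseʳ ε)) (ℚ.*-identityˡ p))

record ℝ : Set where
  field
    seq    : ℕ → ℚ
    cauchy : ∀ ε → 0ℚ < ε → ∃ λ N → ∀ m n → N ℕ.≤ m → N ℕ.≤ n → ∣ seq m - seq n ∣ ≤ ε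

open ℝ public

Within : ℚ → Rel ℝ 0ℓ
Within ε x y = ∃ λ N → ∀ n → N ℕ.≤ n → ∣ seq x n - seq y n ∣ ≤ ε

infix 4 _≃_

_≃_ : Rel ℝ 0ℓ
x ≃ y = ∀ ε → 0ℚ < ε → Within ε x y

fromℚ : ℚ → ℝ
fromℚ q = record
  { seq    = λ _ → q
  ; cauchy = λ ε 0<ε → 0 , λ _ _ _ _ →
      subst (_≤ ε) (sym (cong ∣_∣ (ℚ.+-inverseʳ q))) (ℚ.<⇒≤ 0<ε)
  }

infixl 6 _+ℝ_

_+ℝ_ : ℝ → ℝ → ℝ
x +ℝ y = record
  { seq    = λ n → seq x n + seq y n
  ; cauchy = λ ε 0<ε →
      let M , hx = cauchy x (½ * ε) (half 0<ε)
          N , hy = cauchy y (½ * ε) (half 0<ε)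
      in M ℕ.⊔ N , λ m n m≥ n≥ → subst₂ _≤_
           (cong ∣_∣ (regroup (seq x m) (seq y m) (seq x n) (seq y n)))
           (half+half ε)
           (≤-trans (ℚ.∣p+q∣≤∣p∣+∣q∣ (seq x m - seq x n) (seq y m - seq y n))
             (ℚ.+-mono-≤
               (hx m n (ℕ.≤-trans (ℕ.m≤m⊔n M N) m≥) (ℕ.≤-trans (ℕ.m≤m⊔n M N) n≥))
               (hy m n (ℕ.≤-trans (ℕ.m≤n⊔m M N) m≥) (ℕ.≤-trans (ℕ.m≤n⊔m M N) n≥))))
  }
  where
  open +-*-Solver
  regroup : ∀ a b c d → (a - c) + (b - d) ≡ (a + b) - (c + d)
  regroup = solve 4 (λ a b c d → (a :- c) :+ (b :- d) := (a :+ b) :- (c :+ d)) refl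

∑ℚ : {A : Set} → (A → ℚ) → List A → ℚ
∑ℚ f = foldr (λ a s → f a + s) 0ℚ

∑ℝ : {A : Set} → (A → ℝ) → List A → ℝ
∑ℝ f = foldr (λ a s → f a +ℝ s) (fromℚ 0ℚ)

module _ {A : Set} (f : A → ℚ) where

  ∑ℚ-++ : ∀ xs ys → ∑ℚ f (xs ++ ys) ≡ ∑ℚ f xs + ∑ℚ f ys
  ∑ℚ-++ []       ys = sym (ℚ.+-identityˡ _)
  ∑ℚ-++ (x ∷ xs) ys = trans (cong (_+_ (f x)) (∑ℚ-++ xs ys)) (sym (ℚ.+-assoc (f x) _ _))

  ∑ℚ-map : ∀ {B : Set} c (g : B → ℚ) (h : B → A) → (∀ b → f (h b) ≡ c * g b) →
           ∀ bs → ∑ℚ f (map h bs) ≡ c * ∑ℚ g bs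
  ∑ℚ-map c g h eq []       = sym (ℚ.*-zeroʳ c)
  ∑ℚ-map c g h eq (b ∷ bs) = trans (cong₂ _+_ (eq b) (∑ℚ-map c g h eq bs)) (sym (ℚ.*-distribˡ-+ c _ _))

  module _ (f≥0 : ∀ a → 0ℚ ≤ f a) where

    0≤∑ℚ : ∀ xs → 0ℚ ≤ ∑ℚ f xs
    0≤∑ℚ []       = ≤-refl
    0≤∑ℚ (x ∷ xs) = 0≤+ (f≥0 x) (0≤∑ℚ xs)

    ∑ℚ-⊆ : ∀ {xs ys} → Unique xs → xs ⊆ ys → ∑ℚ f xs ≤ ∑ℚ f ys
    ∑ℚ-⊆ {[]}     {ys} _           _     = 0≤∑ℚ ys
    ∑ℚ-⊆ {x ∷ xs} {ys} (x∉xs ∷ uniq) xs⊆ys with ∈-∃++ (xs⊆ys (here refl))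
    ... | us , vs , refl = subst (f x + ∑ℚ f xs ≤_) (sym eq) (ℚ.+-monoʳ-≤ (f x) (∑ℚ-⊆ uniq xs⊆rest))
      where
      open +-*-Solver
      eq : ∑ℚ f (us ++ x ∷ vs) ≡ f x + ∑ℚ f (us ++ vs)
      eq = trans (∑ℚ-++ us (x ∷ vs))
             (trans (solve 3 (λ u a v → u :+ (a :+ v) := a :+ (u :+ v)) refl (∑ℚ f us) (f x) (∑ℚ f vs))
               (cong (_+_ (f x)) (sym (∑ℚ-++ us vs))))
      xs⊆rest : xs ⊆ us ++ vs
      xs⊆rest y∈xs with ∈-++⁻ us (xs⊆ys (there y∈xs))
      ... | inj₁ y∈us          = ∈-++⁺ˡ y∈us
      ... | inj₂ (here refl)   = ⊥-elim (All.lookup x∉xs y∈xs refl)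
      ... | inj₂ (there y∈vs)  = ∈-++⁺ʳ us y∈vs

-- HasSum P f x: the family of the f a, over all a with P a, is summable with
-- sum x; that is, the sums over finite sets of such a converge to x along the
-- directed set of all finite subsets of P.  A finite set is given by a list
-- without repetitions.
HasSum : {A : Set} → Pred A 0ℓ → (A → ℚ) → ℝ → Set
HasSum {A} P f x = ∀ ε → 0ℚ < ε →
  ∃ λ (S₀ : List A) → All P S₀ ×
    (∀ S → Unique S → All P S → S₀ ⊆ S → Within ε (fromℚ (∑ℚ f S)) x)

-- A family of nonnegative terms is summable if its sums a N over an exhausting
-- sequence of finite sets E N have tails bounded by a null sequence v, as
-- witnessed by a + v being nonincreasing.
module Exhaustion
  {A : Set} (P : Pred A 0ℓ) (f : A → ℚ) (f≥0 : ∀ a → 0ℚ ≤ f a)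
  (E : ℕ → List A)
  (sound    : ∀ N → All P (E N))
  (unique   : ∀ N → Unique (E N))
  (complete : ∀ {x} → P x → ∃ λ N₀ → ∀ N → N₀ ℕ.≤ N → x ∈ E N)
  (a v : ℕ → ℚ)
  (a≡∑   : ∀ N → a N ≡ ∑ℚ f (E N))
  (a-step : ∀ N → a N ≤ a (suc N))
  (v≥0    : ∀ N → 0ℚ ≤ v N)
  (av-step : ∀ N → a (2 ℕ.+ N) + v (2 ℕ.+ N) ≤ a (suc N) + v (suc N))
  (v-null : ∀ ε → 0ℚ < ε → ∃ λ N → v (suc N) ≤ ε)
  where

  private
    monotone : ∀ {i j} → i ℕ.≤′ j → a i ≤ a j
    monotone ℕ.≤′-refl       = ≤-refl
    monotone (ℕ.≤′-step i≤j) = ≤-trans (monotone i≤j) (a-step _)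

    antitone : ∀ {i j} → i ℕ.≤′ j → a (suc j) + v (suc j) ≤ a (suc i) + v (suc i)
    antitone ℕ.≤′-refl       = ≤-refl
    antitone (ℕ.≤′-step i≤j) = ≤-trans (av-step _) (antitone i≤j)

    mono : ∀ {i j} → i ℕ.≤ j → a i ≤ a j
    mono = monotone ∘ ℕ.≤⇒≤′

    tail : ∀ {i j ε} → v (suc i) ≤ ε → suc i ℕ.≤ j → a j ≤ a (suc i) + ε
    tail {i} {suc j} {ε} v≤ε (s≤s i≤j) = begin
      a (suc j)                 ≡⟨ sym (ℚ.+-identityʳ _) ⟩
      a (suc j) + 0ℚ            ≤⟨ ℚ.+-monoʳ-≤ (a (suc j)) (v≥0 (suc j)) ⟩
      a (suc j) + v (suc j)     ≤⟨ antitone (ℕ.≤⇒≤′ i≤j) ⟩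
      a (suc i) + v (suc i)     ≤⟨ ℚ.+-monoʳ-≤ (a (suc i)) v≤ε ⟩
      a (suc i) + ε             ∎
      where open ℚ.≤-Reasoning

    bound : ∀ {S} → All P S → ∃ λ N₀ → ∀ N → N₀ ℕ.≤ N → S ⊆ E N
    bound []       = 0 , λ _ _ ()
    bound (p ∷ ps) =
      let M , hM = complete p
          N , hN = bound ps
      in M ℕ.⊔ N , λ K K≥ → λ
           { (here refl) → hM K (ℕ.≤-trans (ℕ.m≤m⊔n M N) K≥)
           ; (there x∈)  → hN K (ℕ.≤-trans (ℕ.m≤n⊔m M N) K≥) x∈ }

  limit : ℝ
  limit = record
    { seq    = a
    ; cauchy = λ ε 0<ε →
        let N , v≤ε = v-null ε 0<ε
        in suc N , λ m n N≤m N≤n → ∣-∣≤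
             (≤-trans (tail v≤ε N≤m) (ℚ.+-monoˡ-≤ ε (mono N≤n)))
             (≤-trans (tail v≤ε N≤n) (ℚ.+-monoˡ-≤ ε (mono N≤m)))
    }

  hasSum : HasSum P f limit
  hasSum ε 0<ε = E (suc N) , sound (suc N) , λ S S-unique PS E⊆S →
    let M , S⊆E = bound PS
        K = M ℕ.⊔ suc N
    in suc N , λ n N≤n → ∣-∣≤
         (begin
           ∑ℚ f S          ≤⟨ ∑ℚ-⊆ f f≥0 S-unique (S⊆E K (ℕ.m≤m⊔n M (suc N))) ⟩
           ∑ℚ f (E K)      ≡⟨ sym (a≡∑ K) ⟩
           a K             ≤⟨ tail v≤ε (ℕ.m≤n⊔m M (suc N)) ⟩
           a (suc N) + ε   ≤⟨ ℚ.+-monoˡ-≤ ε (mono N≤n) ⟩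
           a n + ε         ∎)
         (begin
           a n                   ≤⟨ tail v≤ε N≤n ⟩
           a (suc N) + ε         ≡⟨ cong (_+ ε) (a≡∑ (suc N)) ⟩
           ∑ℚ f (E (suc N)) + ε  ≤⟨ ℚ.+-monoˡ-≤ ε (∑ℚ-⊆ f f≥0 (unique (suc N)) E⊆S) ⟩
           ∑ℚ f S + ε            ∎)
    where
    N = proj₁ (v-null ε 0<ε)
    v≤ε = proj₂ (v-null ε 0<ε)
    open ℚ.≤-Reasoning

StrictlyDecreasing : Pred (List ℕ) 0ℓ
StrictlyDecreasing n = Linked ℕ._>_ n × All (1 ℕ.≤_) n

IsPartition : Pred (List ℕ) 0ℓ
IsPartition p = Linked ℕ._≥_ p × All (1 ℕ.≤_) p

data Kind : Set where
  strict weak : Kind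

Step : Kind → Rel ℕ 0ℓ
Step strict = ℕ._>_
Step weak   = ℕ._≥_

-- the largest entry allowed after the entry suc N
below : Kind → ℕ → ℕ
below strict N = N
below weak   N = suc N

-- decreasing tuples of length j with all entries ≤ N
tuples : Kind → ℕ → ℕ → List (List ℕ)
tuples κ N       zero    = [] ∷ []
tuples κ zero    (suc j) = []
tuples κ (suc N) (suc j) = tuples κ N (suc j) ++ map (suc N ∷_) (tuples κ (below κ N) j)

IsTuple : Kind → ℕ → Pred (List ℕ) 0ℓ
IsTuple κ j n = (Linked (Step κ) n × All (1 ℕ.≤_) n) × length n ≡ j

Head≤ : ℕ → List ℕ → Set
Head≤ N []      = ⊤
Head≤ N (n ∷ _) = n ℕ.≤ N

Head≤-mono : ∀ {M N} → M ℕ.≤ N → ∀ n → Head≤ M n → Head≤ N n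
Head≤-mono M≤N []      _ = tt
Head≤-mono M≤N (_ ∷ _) h = ℕ.≤-trans h M≤N

step-below : ∀ κ {N n} → n ℕ.≤ below κ N → Step κ (suc N) n
step-below strict = s≤s
step-below weak   = id

below-step : ∀ κ {N n} → Step κ (suc N) n → n ℕ.≤ below κ N
below-step strict = ℕ.s≤s⁻¹
below-step weak   = id

tuples-sound : ∀ κ N j → All (λ n → IsTuple κ j n × Head≤ N n) (tuples κ N j)
tuples-sound κ N       zero    = ((([] , []) , refl) , tt) ∷ []
tuples-sound κ zero    (suc j) = []
tuples-sound κ (suc N) (suc j) = All.++⁺
  (All.map (λ {n} (h , b) → h , Head≤-mono (ℕ.n≤1+n N) n b) (tuples-sound κ N (suc j)))
  (All.map⁺ (All.map extend (tuples-sound κ (below κ N) j)))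
  where
  extend : ∀ {n} → IsTuple κ j n × Head≤ (below κ N) n →
           IsTuple κ (suc j) (suc N ∷ n) × Head≤ (suc N) (suc N ∷ n)
  extend {[]}    (((l , ps) , eq) , b) = (([-] , s≤s z≤n ∷ ps) , cong suc eq) , ℕ.≤-refl
  extend {_ ∷ _} (((l , ps) , eq) , b) =
    ((step-below κ b ∷ l , s≤s z≤n ∷ ps) , cong suc eq) , ℕ.≤-refl

tuples-unique : ∀ κ N j → Unique (tuples κ N j)
tuples-unique κ N       zero    = [] ∷ []
tuples-unique κ zero    (suc j) = []
tuples-unique κ (suc N) (suc j) = Unique.++⁺
  (tuples-unique κ N (suc j))
  (Unique.map⁺ ∷-injectiveʳ (tuples-unique κ (below κ N) j))
  disjoint
  where
  disjoint : ∀ {n} → n ∈ tuples κ N (suc j) × n ∈ map (suc N ∷_) (tuples κ (below κ N) j) → _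
  disjoint (n∈ , n∈′) with ∈-map⁻ (suc N ∷_) n∈′
  ... | _ , _ , refl = ℕ.1+n≰n (proj₂ (All.lookup (tuples-sound κ N (suc j)) n∈))

tuples-complete : ∀ κ N n {j} → IsTuple κ j n → Head≤ N n → n ∈ tuples κ N j
tuples-complete κ N       []         (_ , refl) _ = here refl
tuples-complete κ zero    (zero ∷ _) ((_ , () ∷ _) , refl) _
tuples-complete κ (suc N) (n ∷ ns)   ((l , p ∷ ps) , refl) b =
  [ (λ n<1+N → ∈-++⁺ˡ (tuples-complete κ N (n ∷ ns) ((l , p ∷ ps) , refl) (ℕ.s≤s⁻¹ n<1+N)))
  , (λ { refl → ∈-++⁺ʳ (tuples κ N (suc (length ns)))
       (∈-map⁺ (suc N ∷_) (tuples-complete κ (below κ N) ns ((Linked.tail l , ps) , refl) (next l))) })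
  ]′ (ℕ.m≤n⇒m<n∨m≡n b)
  where
  next : ∀ {xs} → Linked (Step κ) (suc N ∷ xs) → Head≤ (below κ N) xs
  next [-]     = tt
  next (r ∷ _) = below-step κ r

tuples-exhaust : ∀ κ j {n} → IsTuple κ j n → ∃ λ N₀ → ∀ N → N₀ ℕ.≤ N → n ∈ tuples κ N j
tuples-exhaust κ j {[]}     h = 0 , λ N _ → tuples-complete κ N [] h tt
tuples-exhaust κ j {n ∷ ns} h = n , λ N n≤N → tuples-complete κ N (n ∷ ns) h n≤N

∑ℚ-tuples : ∀ κ N j (f g : List ℕ → ℚ) c → (∀ n → f (suc N ∷ n) ≡ c * g n) →
  ∑ℚ f (tuples κ (suc N) (suc j)) ≡ ∑ℚ f (tuples κ N (suc j)) + c * ∑ℚ g (tuples κ (below κ N) j)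
∑ℚ-tuples κ N j f g c eq = trans
  (∑ℚ-++ f (tuples κ N (suc j)) _)
  (cong (_+_ (∑ℚ f (tuples κ N (suc j)))) (∑ℚ-map f c g (suc N ∷_) eq (tuples κ (below κ N) j)))

*recip-≤ : ∀ {p ε} n → p ≤ ε * fromℕ (suc n) → p * recip (suc n) ≤ ε
*recip-≤ {p} {ε} n h = ≤-trans (*-monoˡ (0≤recip (suc n)) h) (≤-reflexive eq)
  where
  eq : ε * fromℕ (suc n) * recip (suc n) ≡ ε
  eq = trans (ℚ.*-assoc ε _ _) (trans (cong (ε *_)
         (trans (ℚ.*-comm (fromℕ (suc n)) _) (recip*fromℕ n))) (ℚ.*-identityʳ ε))

-- For the empty list, ζ takes the usual value 1.
Admissible : Pred (List ℕ) 0ℓ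
Admissible []       = ⊤
Admissible (m ∷ ms) = 2 ℕ.≤ m × All (1 ℕ.≤_) ms

-- 1 / (n₁^m₁ ⋯ nⱼ^mⱼ)
ζ-term : List ℕ → List ℕ → ℚ
ζ-term ms n = recip (product (zipWith ℕ._^_ n ms))

ζ-index : List ℕ → Pred (List ℕ) 0ℓ
ζ-index ms n = StrictlyDecreasing n × length n ≡ length ms

-- the sum of the terms with n₁ ≤ N
ζ-partial : List ℕ → ℕ → ℚ
ζ-partial []       N       = 1ℚ
ζ-partial (m ∷ ms) zero    = 0ℚ
ζ-partial (m ∷ ms) (suc N) = ζ-partial (m ∷ ms) N + recip (suc N ℕ.^ m) * ζ-partial ms N

ζ-partial-≡ : ∀ ms N → ζ-partial ms N ≡ ∑ℚ (ζ-term ms) (tuples strict N (length ms))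
ζ-partial-≡ []       N       = refl
ζ-partial-≡ (m ∷ ms) zero    = refl
ζ-partial-≡ (m ∷ ms) (suc N) = trans
  (cong₂ (λ p q → p + recip (suc N ℕ.^ m) * q) (ζ-partial-≡ (m ∷ ms) N) (ζ-partial-≡ ms N))
  (sym (∑ℚ-tuples strict N (length ms) (ζ-term (m ∷ ms)) (ζ-term ms) (recip (suc N ℕ.^ m))
    (λ n → recip-* (suc N ℕ.^ m) (product (zipWith ℕ._^_ n ms)))))

0≤ζ-partial : ∀ ms N → 0ℚ ≤ ζ-partial ms N
0≤ζ-partial []       N       = 0≤1
0≤ζ-partial (m ∷ ms) zero    = ≤-refl
0≤ζ-partial (m ∷ ms) (suc N) =
  0≤+ (0≤ζ-partial (m ∷ ms) N) (0≤* (0≤recip (suc N ℕ.^ m)) (0≤ζ-partial ms N))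

ζ-partial-step : ∀ ms N → ζ-partial ms N ≤ ζ-partial ms (suc N)
ζ-partial-step []       N = ≤-refl
ζ-partial-step (m ∷ ms) N = ≤-from-gap _ refl (0≤* (0≤recip (suc N ℕ.^ m)) (0≤ζ-partial ms N))

-- With positive exponents, the partial sums are o(N).
ζ-partial-sublinear : ∀ {ms} → All (1 ℕ.≤_) ms → ∀ {ε} → 0ℚ < ε →
  ∃ λ N₀ → ∀ N → N₀ ℕ.≤ N → ζ-partial ms N ≤ ε * fromℕ N
ζ-partial-sublinear []                    0<ε = archimedean 1ℚ 0<ε
ζ-partial-sublinear {m ∷ ms} (1≤m ∷ 1≤ms) {ε} 0<ε =
  M ℕ.⊔ K , λ N N≥ → ≤-trans (growth (ℕ.≤⇒≤′ (ℕ.≤-trans (ℕ.m≤m⊔n M K) N≥)))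
    (≤-trans (ℚ.+-monoˡ-≤ (δ * fromℕ N) (M-bound N (ℕ.≤-trans (ℕ.m≤n⊔m M K) N≥)))
      (≤-reflexive (trans (sym (ℚ.*-distribʳ-+ (fromℕ N) δ δ)) (cong (_* fromℕ N) (half+half ε)))))
  where
  δ = ½ * ε
  0≤δ = ℚ.<⇒≤ (half 0<ε)
  M = proj₁ (ζ-partial-sublinear 1≤ms (half 0<ε))
  tail-bound = proj₂ (ζ-partial-sublinear 1≤ms (half 0<ε))
  C = ζ-partial (m ∷ ms) M
  K = proj₁ (archimedean C (half 0<ε))
  M-bound = proj₂ (archimedean C (half 0<ε))

  increment : ∀ N → M ℕ.≤ N → recip (suc N ℕ.^ m) * ζ-partial ms N ≤ δ
  increment N M≤N = begin
    recip (suc N ℕ.^ m) * ζ-partial ms N  ≤⟨ *-monoˡ (0≤ζ-partial ms N) (recip-^-≤ N 1≤m) ⟩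
    recip (suc N) * ζ-partial ms N        ≡⟨ ℚ.*-comm (recip (suc N)) _ ⟩
    ζ-partial ms N * recip (suc N)        ≤⟨ *recip-≤ N (≤-trans (tail-bound N M≤N) (*-monoʳ 0≤δ (fromℕ-mono (ℕ.n≤1+n N)))) ⟩
    δ                                     ∎
    where open ℚ.≤-Reasoning

  growth : ∀ {N} → M ℕ.≤′ N → ζ-partial (m ∷ ms) N ≤ C + δ * fromℕ N
  growth ℕ.≤′-refl = ≤-from-gap _ refl (0≤* 0≤δ (0≤fromℕ M))
  growth {suc N} (ℕ.≤′-step M≤N) = begin
    ζ-partial (m ∷ ms) N + _     ≤⟨ ℚ.+-mono-≤ (growth M≤N) (increment N (ℕ.≤′⇒≤ M≤N)) ⟩
    (C + δ * fromℕ N) + δ        ≡⟨ solve 3 (λ C δ n → (C :+ δ :* n) :+ δ := C :+ δ :* (con 1ℚ :+ n)) refl C δ (fromℕ N) ⟩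
    C + δ * (1ℚ + fromℕ N)       ≡⟨ cong (λ z → C + δ * z) (sym (fromℕ-suc N)) ⟩
    C + δ * fromℕ (suc N)        ∎
    where
    open ℚ.≤-Reasoning
    open +-*-Solver

-- The sum of ζ-partial ms′ N / N over all suffixes ms′ of ms; by summation by
-- parts it bounds the tail of ζ (2 ∷ ms) beyond N.
ζ-tail : List ℕ → ℕ → ℚ
ζ-tail []       N = recip N
ζ-tail (m ∷ ms) N = ζ-partial (m ∷ ms) N * recip N + ζ-tail ms N

0≤ζ-tail : ∀ ms N → 0ℚ ≤ ζ-tail ms N
0≤ζ-tail []       N = 0≤recip N
0≤ζ-tail (m ∷ ms) N = 0≤+ (0≤* (0≤ζ-partial (m ∷ ms) N) (0≤recip N)) (0≤ζ-tail ms N)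

ζ-tail-step : ∀ {ms} → All (1 ℕ.≤_) ms → ∀ N →
  (recip (2 ℕ.+ N) * recip (2 ℕ.+ N)) * ζ-partial ms (suc N) + ζ-tail ms (2 ℕ.+ N) ≤ ζ-tail ms (suc N)
ζ-tail-step [] N = subst (λ z → z + recip (2 ℕ.+ N) ≤ recip (suc N))
  (sym (ℚ.*-identityʳ (recip (2 ℕ.+ N) * recip (2 ℕ.+ N)))) (recip-telescope N)
ζ-tail-step {m ∷ ms} (1≤m ∷ 1≤ms) N = begin
  (r * r) * Z + ((Z + c * Y) * r + T′)       ≤⟨ ℚ.+-monoʳ-≤ ((r * r) * Z) (ℚ.+-monoˡ-≤ T′ (*-monoˡ 0≤r (ℚ.+-monoʳ-≤ Z (*-monoˡ (0≤ζ-partial ms (suc N)) (recip-^-≤ (suc N) 1≤m))))) ⟩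
  (r * r) * Z + ((Z + r * Y) * r + T′)       ≡⟨ solve 4 (λ r Z Y T → (r :* r) :* Z :+ ((Z :+ r :* Y) :* r :+ T) := Z :* (r :* r :+ r) :+ ((r :* r) :* Y :+ T)) refl r Z Y T′ ⟩
  Z * (r * r + r) + ((r * r) * Y + T′)       ≤⟨ ℚ.+-mono-≤ (*-monoʳ (0≤ζ-partial (m ∷ ms) (suc N)) (recip-telescope N)) (ζ-tail-step 1≤ms N) ⟩
  Z * recip (suc N) + ζ-tail ms (suc N)      ∎
  where
  r = recip (2 ℕ.+ N)
  0≤r = 0≤recip (2 ℕ.+ N)
  c = recip ((2 ℕ.+ N) ℕ.^ m)
  Z = ζ-partial (m ∷ ms) (suc N)
  Y = ζ-partial ms (suc N)
  T′ = ζ-tail ms (2 ℕ.+ N)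
  open ℚ.≤-Reasoning
  open +-*-Solver

ζ-tail-null : ∀ {ms} → All (1 ℕ.≤_) ms → ∀ {ε} → 0ℚ < ε →
  ∃ λ N₀ → ∀ N → N₀ ℕ.≤ N → ζ-tail ms (suc N) ≤ ε
ζ-tail-null [] {ε} 0<ε =
  let N₀ , h = archimedean 1ℚ 0<ε
  in N₀ , λ N N₀≤N → subst (_≤ ε) (ℚ.*-identityˡ (recip (suc N)))
       (*recip-≤ N (h (suc N) (ℕ.m≤n⇒m≤1+n N₀≤N)))
ζ-tail-null {m ∷ ms} (1≤m ∷ 1≤ms) {ε} 0<ε =
  let N₁ , h₁ = ζ-partial-sublinear (1≤m ∷ 1≤ms) (half 0<ε)
      N₂ , h₂ = ζ-tail-null 1≤ms (half 0<ε)
  in N₁ ℕ.⊔ N₂ , λ N N≥ → subst (ζ-tail (m ∷ ms) (suc N) ≤_) (half+half ε)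
       (ℚ.+-mono-≤
         (*recip-≤ {ε = ½ * ε} N (h₁ (suc N) (ℕ.m≤n⇒m≤1+n (ℕ.≤-trans (ℕ.m≤m⊔n N₁ N₂) N≥))))
         (h₂ N (ℕ.≤-trans (ℕ.m≤n⊔m N₁ N₂) N≥)))

ζ-converges : ∀ ms → Admissible ms → ∃ λ x → HasSum (ζ-index ms) (ζ-term ms) x
ζ-converges [] _ = limit , hasSum
  where
  open Exhaustion (ζ-index []) (ζ-term []) (λ n → 0≤recip (product (zipWith ℕ._^_ n [])))
    (λ N → tuples strict N 0)
    (λ N → All.map proj₁ (tuples-sound strict N 0)) (λ N → tuples-unique strict N 0)
    (tuples-exhaust strict 0)
    (ζ-partial []) (λ _ → 0ℚ)
    (ζ-partial-≡ []) (ζ-partial-step []) (λ _ → ≤-refl) (λ _ → ≤-refl)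
    (λ ε 0<ε → 0 , ℚ.<⇒≤ 0<ε)
ζ-converges (m ∷ ms) (2≤m , 1≤ms) = limit , hasSum
  where
  step : ∀ N → ζ-partial (m ∷ ms) (2 ℕ.+ N) + ζ-tail ms (2 ℕ.+ N) ≤ ζ-partial (m ∷ ms) (suc N) + ζ-tail ms (suc N)
  step N = begin
    (Z + c * Y) + T′             ≤⟨ ℚ.+-monoˡ-≤ T′ (ℚ.+-monoʳ-≤ Z (*-monoˡ (0≤ζ-partial ms (suc N)) (recip-^-≤² (suc N) 2≤m))) ⟩
    (Z + (r * r) * Y) + T′       ≡⟨ ℚ.+-assoc Z _ T′ ⟩
    Z + ((r * r) * Y + T′)       ≤⟨ ℚ.+-monoʳ-≤ Z (ζ-tail-step 1≤ms N) ⟩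
    Z + ζ-tail ms (suc N)        ∎
    where
    r = recip (2 ℕ.+ N)
    c = recip ((2 ℕ.+ N) ℕ.^ m)
    Z = ζ-partial (m ∷ ms) (suc N)
    Y = ζ-partial ms (suc N)
    T′ = ζ-tail ms (2 ℕ.+ N)
    open ℚ.≤-Reasoning
  null : ∀ ε → 0ℚ < ε → ∃ λ N → ζ-tail ms (suc N) ≤ ε
  null ε 0<ε = let N , h = ζ-tail-null 1≤ms 0<ε in N , h N ℕ.≤-refl
  open Exhaustion (ζ-index (m ∷ ms)) (ζ-term (m ∷ ms)) (λ n → 0≤recip (product (zipWith ℕ._^_ n (m ∷ ms))))
    (λ N → tuples strict N (suc (length ms)))
    (λ N → All.map proj₁ (tuples-sound strict N (suc (length ms)))) (λ N → tuples-unique strict N (suc (length ms)))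
    (tuples-exhaust strict (suc (length ms)))
    (ζ-partial (m ∷ ms)) (ζ-tail ms)
    (ζ-partial-≡ (m ∷ ms)) (ζ-partial-step (m ∷ ms)) (0≤ζ-tail ms) step
    null

ζ : ∀ ms → Admissible ms → ℝ
ζ ms adm = proj₁ (ζ-converges ms adm)

ζᴾ-index : ℕ → Pred (List ℕ) 0ℓ
ζᴾ-index k p = IsPartition p × length p ≡ k

ζᴾ-term : ℕ → List ℕ → ℚ
ζᴾ-term m p = recip (product p ℕ.^ m)

-- the sum of the terms with largest part ≤ N
ζᴾ-partial : ℕ → ℕ → ℕ → ℚ
ζᴾ-partial m zero    N       = 1ℚ
ζᴾ-partial m (suc k) zero    = 0ℚ
ζᴾ-partial m (suc k) (suc N) = ζᴾ-partial m (suc k) N + recip (suc N ℕ.^ m) * ζᴾ-partial m k (suc N)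

*-^ : ∀ a b m → (a ℕ.* b) ℕ.^ m ≡ a ℕ.^ m ℕ.* b ℕ.^ m
*-^ a b zero    = refl
*-^ a b (suc m) = trans (cong (a ℕ.* b ℕ.*_) (*-^ a b m)) (ℕ.[m*n]*[o*p]≡[m*o]*[n*p] a b (a ℕ.^ m) (b ℕ.^ m))

ζᴾ-partial-≡ : ∀ m k N → ζᴾ-partial m k N ≡ ∑ℚ (ζᴾ-term m) (tuples weak N k)
ζᴾ-partial-≡ m zero    N       =
  sym (trans (ℚ.+-identityʳ (recip (1 ℕ.^ m))) (cong recip (ℕ.^-zeroˡ m)))
ζᴾ-partial-≡ m (suc k) zero    = refl
ζᴾ-partial-≡ m (suc k) (suc N) = trans
  (cong₂ (λ p q → p + recip (suc N ℕ.^ m) * q) (ζᴾ-partial-≡ m (suc k) N) (ζᴾ-partial-≡ m k (suc N)))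
  (sym (∑ℚ-tuples weak N k (ζᴾ-term m) (ζᴾ-term m) (recip (suc N ℕ.^ m))
    (λ p → trans (cong recip (*-^ (suc N) (product p) m)) (recip-* (suc N ℕ.^ m) _))))

0≤ζᴾ-partial : ∀ m k N → 0ℚ ≤ ζᴾ-partial m k N
0≤ζᴾ-partial m zero    N       = 0≤1
0≤ζᴾ-partial m (suc k) zero    = ≤-refl
0≤ζᴾ-partial m (suc k) (suc N) =
  0≤+ (0≤ζᴾ-partial m (suc k) N) (0≤* (0≤recip (suc N ℕ.^ m)) (0≤ζᴾ-partial m k (suc N)))

ζᴾ-partial-step : ∀ m k N → ζᴾ-partial m k N ≤ ζᴾ-partial m k (suc N)
ζᴾ-partial-step m zero    N = ≤-refl
ζᴾ-partial-step m (suc k) N = ≤-from-gap _ refl (0≤* (0≤recip (suc N ℕ.^ m)) (0≤ζᴾ-partial m k (suc N)))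

-- 2^k, an upper bound of the partial sums
ζᴾ-bound : ℕ → ℚ
ζᴾ-bound zero    = 1ℚ
ζᴾ-bound (suc k) = ζᴾ-bound k + ζᴾ-bound k

0≤ζᴾ-bound : ∀ k → 0ℚ ≤ ζᴾ-bound k
0≤ζᴾ-bound zero    = 0≤1
0≤ζᴾ-bound (suc k) = 0≤+ (0≤ζᴾ-bound k) (0≤ζᴾ-bound k)

ζᴾ-tail : ℕ → ℕ → ℚ
ζᴾ-tail k N = ζᴾ-bound k * recip N

module _ {m} (2≤m : 2 ℕ.≤ m) where

  ζᴾ-tail-step : ∀ k → (∀ N → ζᴾ-partial m k N ≤ ζᴾ-bound k) → ∀ N →
    ζᴾ-partial m (suc k) (2 ℕ.+ N) + ζᴾ-tail k (2 ℕ.+ N) ≤ ζᴾ-partial m (suc k) (suc N) + ζᴾ-tail k (suc N)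
  ζᴾ-tail-step k P≤B N = begin
    (Z + c * Y) + B * r          ≤⟨ ℚ.+-monoˡ-≤ (B * r) (ℚ.+-monoʳ-≤ Z (*-mono (0≤ζᴾ-partial m k (2 ℕ.+ N)) (0≤* 0≤r 0≤r) (recip-^-≤² (suc N) 2≤m) (P≤B (2 ℕ.+ N)))) ⟩
    (Z + (r * r) * B) + B * r    ≡⟨ solve 3 (λ Z r B → (Z :+ (r :* r) :* B) :+ B :* r := Z :+ B :* (r :* r :+ r)) refl Z r B ⟩
    Z + B * (r * r + r)          ≤⟨ ℚ.+-monoʳ-≤ Z (*-monoʳ (0≤ζᴾ-bound k) (recip-telescope N)) ⟩
    Z + B * recip (suc N)        ∎
    where
    r = recip (2 ℕ.+ N)
    0≤r = 0≤recip (2 ℕ.+ N)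
    c = recip ((2 ℕ.+ N) ℕ.^ m)
    Z = ζᴾ-partial m (suc k) (suc N)
    Y = ζᴾ-partial m k (2 ℕ.+ N)
    B = ζᴾ-bound k
    open ℚ.≤-Reasoning
    open +-*-Solver

  ζᴾ-partial-≤ : ∀ k N → ζᴾ-partial m k N ≤ ζᴾ-bound k
  ζᴾ-partial-≤ zero    N       = ≤-refl
  ζᴾ-partial-≤ (suc k) zero    = 0≤ζᴾ-bound (suc k)
  ζᴾ-partial-≤ (suc k) (suc N) = ≤-trans
    (≤-from-gap _ refl (0≤* (0≤ζᴾ-bound k) (0≤recip (suc N)))) (bounded N)
    where
    B = ζᴾ-bound k
    bounded : ∀ N → ζᴾ-partial m (suc k) (suc N) + ζᴾ-tail k (suc N) ≤ B + B
    bounded (suc N) = ≤-trans (ζᴾ-tail-step k (ζᴾ-partial-≤ k) N) (bounded N)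
    bounded zero    = ℚ.+-mono-≤
      (begin
        0ℚ + recip (1 ℕ.^ m) * ζᴾ-partial m k 1   ≡⟨ ℚ.+-identityˡ _ ⟩
        recip (1 ℕ.^ m) * ζᴾ-partial m k 1        ≡⟨ cong (λ z → recip z * ζᴾ-partial m k 1) (ℕ.^-zeroˡ m) ⟩
        1ℚ * ζᴾ-partial m k 1                     ≡⟨ ℚ.*-identityˡ _ ⟩
        ζᴾ-partial m k 1                          ≤⟨ ζᴾ-partial-≤ k 1 ⟩
        B                                         ∎)
      (≤-reflexive (ℚ.*-identityʳ B))
      where open ℚ.≤-Reasoning

  ζᴾ-converges : ∀ k → ∃ λ x → HasSum (ζᴾ-index k) (ζᴾ-term m) x
  ζᴾ-converges zero = limit , hasSum
    where
    open Exhaustion (ζᴾ-index 0) (ζᴾ-term m) (λ p → 0≤recip (product p ℕ.^ m))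
      (λ N → tuples weak N 0)
      (λ N → All.map proj₁ (tuples-sound weak N 0)) (λ N → tuples-unique weak N 0)
      (tuples-exhaust weak 0)
      (ζᴾ-partial m 0) (λ _ → 0ℚ)
      (ζᴾ-partial-≡ m 0) (ζᴾ-partial-step m 0) (λ _ → ≤-refl) (λ _ → ≤-refl)
      (λ ε 0<ε → 0 , ℚ.<⇒≤ 0<ε)
  ζᴾ-converges (suc k) = limit , hasSum
    where
    null : ∀ ε → 0ℚ < ε → ∃ λ N → ζᴾ-tail k (suc N) ≤ ε
    null ε 0<ε = let N , h = archimedean (ζᴾ-bound k) 0<ε in N , *recip-≤ N (h (suc N) (ℕ.n≤1+n N))
    open Exhaustion (ζᴾ-index (suc k)) (ζᴾ-term m) (λ p → 0≤recip (product p ℕ.^ m))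
      (λ N → tuples weak N (suc k))
      (λ N → All.map proj₁ (tuples-sound weak N (suc k))) (λ N → tuples-unique weak N (suc k))
      (tuples-exhaust weak (suc k))
      (ζᴾ-partial m (suc k)) (ζᴾ-tail k)
      (ζᴾ-partial-≡ m (suc k)) (ζᴾ-partial-step m (suc k))
      (λ N → 0≤* (0≤ζᴾ-bound k) (0≤recip N))
      (ζᴾ-tail-step k (ζᴾ-partial-≤ k))
      null

-- ζᴾ m k is the sum of n_λ^(-m) over the partitions λ with k parts.
ζᴾ : ∀ m → ℕ → 2 ℕ.≤ m → ℝ
ζᴾ m k 2≤m = proj₁ (ζᴾ-converges 2≤m k)

record Composition : Set where
  constructor ⟨_,_⟩
  field
    parts        : List ℕ
    all-positive : All (1 ℕ.≤_) parts

open Composition public using (parts)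

size : Composition → ℕ
size a = sum (parts a)

parts-injective : ∀ {a b} → parts a ≡ parts b → a ≡ b
parts-injective {⟨ a , p ⟩} {⟨ _ , q ⟩} refl = cong ⟨ a ,_⟩ (All.irrelevant ℕ.≤-irrelevant p q)

-- The compositions obtained from a given one by prepending a part 1 or by
-- adding 1 to the first part.
grow : Composition → List Composition
grow ⟨ [] , _ ⟩           = ⟨ 1 ∷ [] , s≤s z≤n ∷ [] ⟩ ∷ []
grow ⟨ a₁ ∷ as , p ∷ ps ⟩ = ⟨ 1 ∷ a₁ ∷ as , s≤s z≤n ∷ p ∷ ps ⟩ ∷ ⟨ suc a₁ ∷ as , s≤s z≤n ∷ ps ⟩ ∷ []

compositions : ℕ → List Composition
compositions zero    = ⟨ [] , [] ⟩ ∷ []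
compositions (suc k) = concatMap grow (compositions k)

compositions-sound : ∀ k → All (λ a → size a ≡ k) (compositions k)
compositions-sound zero    = refl ∷ []
compositions-sound (suc k) = All.concat⁺ (All.map⁺ (All.map size-grow (compositions-sound k)))
  where
  size-grow : ∀ {a} → size a ≡ k → All (λ b → size b ≡ suc k) (grow a)
  size-grow {⟨ [] , _ ⟩}         eq = cong suc eq ∷ []
  size-grow {⟨ _ ∷ _ , _ ∷ _ ⟩}  eq = cong suc eq ∷ cong suc eq ∷ []

compositions-complete : ∀ a → a ∈ compositions (size a)
compositions-complete a = complete (size a) a refl
  where
  complete : ∀ k a → size a ≡ k → a ∈ compositions k
  complete zero    ⟨ [] , [] ⟩              _  = here refl
  complete zero    ⟨ suc _ ∷ _ , _ ⟩        ()
  complete zero    ⟨ zero ∷ _ , () ∷ _ ⟩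
  complete (suc k) ⟨ zero ∷ _ , () ∷ _ ⟩
  complete (suc k) ⟨ suc zero ∷ [] , s≤s z≤n ∷ [] ⟩ refl = here refl
  complete (suc k) ⟨ suc zero ∷ b ∷ as , s≤s z≤n ∷ p ∷ ps ⟩ eq =
    ∈-concatMap⁺ grow (lose (complete k ⟨ b ∷ as , p ∷ ps ⟩ (ℕ.suc-injective eq)) (here refl))
  complete (suc k) ⟨ suc (suc b) ∷ as , s≤s z≤n ∷ ps ⟩ eq =
    ∈-concatMap⁺ grow (lose (complete k ⟨ suc b ∷ as , s≤s z≤n ∷ ps ⟩ (ℕ.suc-injective eq)) (there (here refl)))

compositions-unique : ∀ k → Unique (compositions k)
compositions-unique zero    = [] ∷ []
compositions-unique (suc k) = Unique.concat⁺
  (All.map⁺ (All.universal grow-unique (compositions k)))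
  (AllPairs.map⁺ (AllPairs.map disjoint (compositions-unique k)))
  where
  grow-unique : ∀ a → Unique (grow a)
  grow-unique ⟨ [] , _ ⟩                    = [] ∷ []
  grow-unique ⟨ zero ∷ _ , () ∷ _ ⟩
  grow-unique ⟨ suc _ ∷ _ , _ ∷ _ ⟩         = ((λ ()) ∷ []) ∷ [] ∷ []

  shrink : List ℕ → List ℕ
  shrink (suc (suc a) ∷ as) = suc a ∷ as
  shrink (_ ∷ as)           = as
  shrink []                 = []

  shrink-grow : ∀ a {b} → b ∈ grow a → shrink (parts b) ≡ parts a
  shrink-grow ⟨ [] , _ ⟩            (here refl)         = refl
  shrink-grow ⟨ zero ∷ _ , () ∷ _ ⟩ _
  shrink-grow ⟨ suc _ ∷ _ , _ ∷ _ ⟩ (here refl)         = refl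
  shrink-grow ⟨ suc _ ∷ _ , _ ∷ _ ⟩ (there (here refl)) = refl

  disjoint : ∀ {a b} → a ≢ b → Disjoint (grow a) (grow b)
  disjoint {a} {b} a≢b (c∈a , c∈b) =
    a≢b (parts-injective (trans (sym (shrink-grow a c∈a)) (shrink-grow b c∈b)))

infixr 7 _·_

-- (a₁, …, aⱼ) ↦ (a₁ m, …, aⱼ m)
_·_ : Composition → ℕ → List ℕ
a · m = map (ℕ._* m) (parts a)

·-admissible : ∀ {m} → 2 ℕ.≤ m → ∀ a → Admissible (a · m)
·-admissible         2≤m ⟨ [] , _ ⟩          = tt
·-admissible {m} 2≤m ⟨ a₁ ∷ as , p ∷ ps ⟩ =
  ℕ.≤-trans 2≤m (m≤b*m p) , All.map⁺ (All.map (λ q → ℕ.≤-trans (ℕ.≤-trans (s≤s z≤n) 2≤m) (m≤b*m q)) ps)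
  where
  m≤b*m : ∀ {b} → 1 ℕ.≤ b → m ℕ.≤ b ℕ.* m
  m≤b*m {suc b} _ = ℕ.m≤m+n m (b ℕ.* m)

{-# OPTIONS --safe #-}
module Submission where

-- Both sides are limits of truncated sums, and the truncations agree exactly:
-- for every N, the sum over partitions with k parts, all at most N, equals the
-- sum over compositions a of k of the multiple zeta sums for a m restricted to
-- n₁ ≤ N.  Combinatorially, grouping equal parts of a partition gives a strictly
-- decreasing tuple together with the composition of multiplicities.
--
-- The truncated identity (ζᴾ-partial≡∑ζ-partial) is proved by induction on k and
-- N.  The partition sums P(k, N) are defined by
--   P(k + 1, N + 1) = P(k + 1, N) + (N + 1)^(-m) P(k, N + 1),
-- according to whether the largest part is N + 1.  The composition sums satisfy
-- the same recurrence because it already holds between a composition a of k and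
-- the compositions of k + 1 that grow from it (∑-grow-suc): a largest part N + 1
-- of multiplicity 1 corresponds to prepending 1 to a, and one of higher
-- multiplicity to increasing the first entry of a.

open import Defs
open import Data.Nat.Base using (ℕ; zero; suc; _≤_)
import Data.Nat.Base as ℕ
import Data.Nat.Properties as ℕ
open import Data.Rational.Base using (ℚ; 0ℚ; 1ℚ; _+_; _*_; _-_; ∣_∣)
import Data.Rational.Base as ℚ
import Data.Rational.Properties as ℚ
open import Data.Rational.Solver using (module +-*-Solver)
open import Data.List.Base using (List; []; _∷_; map; concatMap)
open import Data.List.Relation.Unary.All using ([]; _∷_)
open import Data.Product.Base using (_,_)
open import Relation.Binary.PropositionalEquality
  using (_≡_; refl; sym; trans; cong; cong₂; subst; module ≡-Reasoning)

seq-≡⇒≃ : ∀ x y → (∀ n → seq x n ≡ seq y n) → x ≃ y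
seq-≡⇒≃ x y eq ε 0<ε = 0 , λ n _ → subst (ℚ._≤ ε)
  (sym (cong ∣_∣ (trans (cong (_- seq y n) (eq n)) (ℚ.+-inverseʳ (seq y n)))))
  (ℚ.<⇒≤ 0<ε)

seq-∑ℝ : ∀ {A : Set} (f : A → ℝ) (g : A → ℚ) n → (∀ a → seq (f a) n ≡ g a) →
  ∀ as → seq (∑ℝ f as) n ≡ ∑ℚ g as
seq-∑ℝ f g n eq []       = refl
seq-∑ℝ f g n eq (a ∷ as) = cong₂ _+_ (eq a) (seq-∑ℝ f g n eq as)

-- ζ and ζᴾ are defined by cases, so their approximating sequences reduce to the
-- truncated sums only once the list of exponents, or the length, is split.
seq-ζ : ∀ ms adm N → seq (ζ ms adm) N ≡ ζ-partial ms N
seq-ζ []       _       N = refl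
seq-ζ (m ∷ ms) (_ , _) N = refl

seq-ζᴾ : ∀ m k (2≤m : 2 ≤ m) N → seq (ζᴾ m k 2≤m) N ≡ ζᴾ-partial m k N
seq-ζᴾ m zero    2≤m N = refl
seq-ζᴾ m (suc k) 2≤m N = refl

∑ℚ-concatMap-zero : ∀ {A B : Set} (f : B → ℚ) (g : A → List B) →
  (∀ a → ∑ℚ f (g a) ≡ 0ℚ) → ∀ as → ∑ℚ f (concatMap g as) ≡ 0ℚ
∑ℚ-concatMap-zero f g eq []       = refl
∑ℚ-concatMap-zero f g eq (a ∷ as) = trans (∑ℚ-++ f (g a) (concatMap g as))
  (cong₂ _+_ (eq a) (∑ℚ-concatMap-zero f g eq as))

∑ℚ-concatMap-+* : ∀ {A B : Set} (f f′ : B → ℚ) (h : A → ℚ) c (g : A → List B) →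
  (∀ a → ∑ℚ f (g a) ≡ ∑ℚ f′ (g a) + c * h a) →
  ∀ as → ∑ℚ f (concatMap g as) ≡ ∑ℚ f′ (concatMap g as) + c * ∑ℚ h as
∑ℚ-concatMap-+* f f′ h c g eq []       =
  sym (trans (ℚ.+-identityˡ (c * 0ℚ)) (ℚ.*-zeroʳ c))
∑ℚ-concatMap-+* f f′ h c g eq (a ∷ as) = begin
  ∑ℚ f (concatMap g (a ∷ as))
    ≡⟨ ∑ℚ-++ f (g a) (concatMap g as) ⟩
  ∑ℚ f (g a) + ∑ℚ f (concatMap g as)
    ≡⟨ cong₂ _+_ (eq a) (∑ℚ-concatMap-+* f f′ h c g eq as) ⟩
  (∑ℚ f′ (g a) + c * h a) + (∑ℚ f′ (concatMap g as) + c * ∑ℚ h as)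
    ≡⟨ solve 5 (λ u x v y c → (u :+ c :* x) :+ (v :+ c :* y) := (u :+ v) :+ c :* (x :+ y))
         refl (∑ℚ f′ (g a)) (h a) (∑ℚ f′ (concatMap g as)) (∑ℚ h as) c ⟩
  (∑ℚ f′ (g a) + ∑ℚ f′ (concatMap g as)) + c * (h a + ∑ℚ h as)
    ≡⟨ cong (_+ c * (h a + ∑ℚ h as)) (sym (∑ℚ-++ f′ (g a) (concatMap g as))) ⟩
  ∑ℚ f′ (concatMap g (a ∷ as)) + c * ∑ℚ h (a ∷ as) ∎
  where
  open +-*-Solver
  open ≡-Reasoning

recip-^-+ : ∀ n a b → recip (n ℕ.^ (a ℕ.+ b)) ≡ recip (n ℕ.^ a) * recip (n ℕ.^ b)
recip-^-+ n a b = trans (cong recip (ℕ.^-distribˡ-+-* n a b)) (recip-* (n ℕ.^ a) (n ℕ.^ b))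

module _ (m : ℕ) where

  -- The multiple zeta sum with exponents a₁ m, …, aⱼ m, restricted to n₁ ≤ N.
  Z : ℕ → Composition → ℚ
  Z N a = ζ-partial (a · m) N

  ∑-grow-zero : ∀ a → ∑ℚ (Z 0) (grow a) ≡ 0ℚ
  ∑-grow-zero ⟨ [] , _ ⟩        = refl
  ∑-grow-zero ⟨ _ ∷ _ , _ ∷ _ ⟩ = refl

  -- The recurrence of the partition sums, for a single composition a.  The terms
  -- with n₁ = N + 1 come from prepending 1 to a (then n₂ ≤ N), or from raising the
  -- first exponent by m (then n₁ already occurs in Z (N + 1) a); together they
  -- make up (N + 1)^(-m) Z (N + 1) a.
  ∑-grow-suc : ∀ N a →
    ∑ℚ (Z (suc N)) (grow a) ≡ ∑ℚ (Z N) (grow a) + recip (suc N ℕ.^ m) * Z (suc N) a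
  ∑-grow-suc N ⟨ [] , _ ⟩ = begin
    (X + y * 1ℚ) + 0ℚ   ≡⟨ solve 2 (λ X y → (X :+ y :* con 1ℚ) :+ con 0ℚ := (X :+ con 0ℚ) :+ y :* con 1ℚ) refl X y ⟩
    (X + 0ℚ) + y * 1ℚ   ≡⟨ cong (λ e → (X + 0ℚ) + recip (suc N ℕ.^ e) * 1ℚ) (ℕ.*-identityˡ m) ⟩
    (X + 0ℚ) + x * 1ℚ   ∎
    where
    x = recip (suc N ℕ.^ m)
    y = recip (suc N ℕ.^ (1 ℕ.* m))
    X = ζ-partial (1 ℕ.* m ∷ []) N
    open +-*-Solver
    open ≡-Reasoning
  ∑-grow-suc N ⟨ a ∷ as , p ∷ ps ⟩ = begin
    (U + recip (suc N ℕ.^ (1 ℕ.* m)) * W) + ((V + recip (suc N ℕ.^ (suc a ℕ.* m)) * Y) + 0ℚ)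
      ≡⟨ cong₂ (λ s t → (U + s * W) + ((V + t * Y) + 0ℚ))
           (cong (λ e → recip (suc N ℕ.^ e)) (ℕ.*-identityˡ m))
           (recip-^-+ (suc N) m (a ℕ.* m)) ⟩
    (U + x * W) + ((V + (x * z) * Y) + 0ℚ)
      ≡⟨ solve 6 (λ U V W Y x z →
           (U :+ x :* W) :+ ((V :+ (x :* z) :* Y) :+ con 0ℚ)
             := (U :+ (V :+ con 0ℚ)) :+ x :* (W :+ z :* Y))
           refl U V W Y x z ⟩
    (U + (V + 0ℚ)) + x * (W + z * Y) ∎
    where
    ms = map (ℕ._* m) as
    x = recip (suc N ℕ.^ m)
    z = recip (suc N ℕ.^ (a ℕ.* m))
    U = ζ-partial (1 ℕ.* m ∷ a ℕ.* m ∷ ms) N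
    V = ζ-partial (suc a ℕ.* m ∷ ms) N
    W = ζ-partial (a ℕ.* m ∷ ms) N
    Y = ζ-partial ms N
    open +-*-Solver
    open ≡-Reasoning

  ζᴾ-partial≡∑ζ-partial : ∀ k N → ζᴾ-partial m k N ≡ ∑ℚ (Z N) (compositions k)
  ζᴾ-partial≡∑ζ-partial zero    N       = refl
  ζᴾ-partial≡∑ζ-partial (suc k) zero    =
    sym (∑ℚ-concatMap-zero (Z 0) grow ∑-grow-zero (compositions k))
  ζᴾ-partial≡∑ζ-partial (suc k) (suc N) = trans
    (cong₂ (λ p q → p + recip (suc N ℕ.^ m) * q)
      (ζᴾ-partial≡∑ζ-partial (suc k) N) (ζᴾ-partial≡∑ζ-partial k (suc N)))
    (sym (∑ℚ-concatMap-+* (Z (suc N)) (Z N) (Z (suc N)) (recip (suc N ℕ.^ m)) grow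
      (∑-grow-suc N) (compositions k)))

proposition2 : (m k : ℕ) (2≤m : 2 ≤ m) → 1 ≤ k →
    ζᴾ m k 2≤m ≃ ∑ℝ (λ a → ζ (a · m) (·-admissible 2≤m a)) (compositions k)
proposition2 m k 2≤m _ =
  seq-≡⇒≃ (ζᴾ m k 2≤m) (∑ℝ ζₐ (compositions k)) λ N →
    trans (seq-ζᴾ m k 2≤m N)
      (trans (ζᴾ-partial≡∑ζ-partial m k N)
        (sym (seq-∑ℝ ζₐ (Z m N) N
          (λ a → seq-ζ (a · m) (·-admissible 2≤m a) N) (compositions k))))
  where
  ζₐ : Composition → ℝ
  ζₐ a = ζ (a · m) (·-admissible 2≤m a)
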